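{- (i) $\sim^{\neg\neg}_V$ and $\sim^{almost}_V$ are equivalence relations on $\mathcal{N}$. (ii) For every $R\in\mathcal{E}$: $\sim_V\subseteq R\subseteq\sim^{\neg\neg}_V$. (iii) For every $R\in\mathcal{E}$: $R\subseteq\sim^{almost}_V$. (iv) For all $\alpha,\beta$: if $\alpha\sim^{almost}_V\beta$ then there exists $R\in\mathcal{E}$ with $\alpha R\beta$. (v) For all $\alpha,\beta$: if $\alpha\sim^{almost}_V\beta$ then $\alpha\sim^{\neg\neg}_V\beta$.
   Context: Intuitionistic mathematics (constructive reading of logical constants; Markov's Principle not assumed); generalized inductive definitions are admitted. Axioms assumed: the Second Axiom of Countable Choice (for every $R\subseteq\mathbb{N}\times\mathcal{N}$, if $\forall n\exists\alpha[nR\alpha]$ then $\exists\alpha\forall n[nR\alpha^n]$, where $\alpha^n(m)=\alpha(J(n,m))$ for a fixed pairing bijection $J$), and the Principle of Bar Induction: for all $B,C\subseteq[\omega]^{<\omega}$, if $\forall\zeta\in[\omega]^\omega\exists n[\overline{\zeta}n\in B]$, $B\subseteq C$, and $\forall s\in[\omega]^{<\omega}[s\in C\leftrightarrow\forall n[s\ast\langle n\rangle\in[\omega]^{<\omega}\rightarrow s\ast\langle n\rangle\in C]]$, then $\langle\,\rangle\in C$. Notation: $\mathcal{N}=\omega^\omega$; $\overline{\zeta}n=\langle\zeta(0),\dots,\zeta(n-1)\rangle$; $[\omega]^\omega$ is the set of strictly increasing $\zeta\in\mathcal{N}$ and $[\omega]^{<\omega}$ the set of (codes of) strictly increasing finite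 sequences. $\alpha\sim_V\beta$ iff $\exists n\forall m>n[\alpha(m)=\beta(m)]$. For a binary relation $R$ on $\mathcal{N}$: $\alpha R^+\beta$ iff $\exists n\forall m>n[\alpha(m)\neq\beta(m)\rightarrow\alpha R\beta]$. $\mathcal{E}$ is the least class of binary relations on $\mathcal{N}$ containing $\sim_V$, closed under $R\mapsto R^+$, and closed under unions $\bigcup_iR_i$ of infinite sequences $R_0,R_1,\dots$ of its members. $\alpha\sim^{\neg\neg}_V\beta$ iff $\neg\neg(\alpha\sim_V\beta)$; $\alpha\sim^{almost}_V\beta$ iff $\forall\zeta\in[\omega]^\omega\exists n[\alpha(\zeta(n))=\beta(\zeta(n))]$. -}

module Defs where

open import Data.List.Base using (List; []; _∷ʳ_; applyUpTo)
open import Data.List.Relation.Unary.Linked using (Linked)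
open import Data.Nat.Base using (ℕ; _<_; _>_)
open import Data.Product.Base using (∃; _×_; _,_)
open import Function.Bundles using (_⤖_; module Bijection) renaming (_⇔_ to _iff_)
open import Level using (0ℓ)
open import Relation.Binary.Core using (Rel; _⇔_)
open import Relation.Binary.Definitions using (Monotonic₁)
open import Relation.Binary.PropositionalEquality.Core using (_≡_; _≢_; _≗_)
open import Relation.Nullary.Negation.Core using (¬_)
open import Relation.Unary using (Pred; _∈_; _⊆_)

𝒩 : Set
𝒩 = ℕ → ℕ

[ω]^ω : Pred 𝒩 0ℓ
[ω]^ω ζ = Monotonic₁ _<_ _<_ ζ

-- Finite sequences are lists themselves rather than natural-number codes.
[ω]^<ω : Pred (List ℕ) 0ℓ
[ω]^<ω s = Linked _<_ s

initial : 𝒩 → ℕ → List ℕ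
initial ζ n = applyUpTo ζ n

-- α ^[ J , n ] is the n-th subsequence αⁿ of α with respect to the pairing J.
_^[_,_] : 𝒩 → (ℕ × ℕ) ⤖ ℕ → ℕ → 𝒩
(α ^[ J , n ]) m = α (Bijection.to J (n , m))

-- Subsets of ℕ × 𝒩 are extensional: equality on 𝒩 is pointwise equality.
-- The second argument says this for the Set-valued R.
SecondCountableChoice : (ℕ × ℕ) ⤖ ℕ → Set₁
SecondCountableChoice J =
  (R : ℕ → 𝒩 → Set) →
  (∀ n {α β} → α ≗ β → R n α → R n β) →
  (∀ n → ∃ λ α → R n α) →
  ∃ λ α → ∀ n → R n (α ^[ J , n ])

BarInduction : Set₁
BarInduction =
  (B C : Pred (List ℕ) 0ℓ) → B ⊆ [ω]^<ω → C ⊆ [ω]^<ω →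
  (∀ ζ → ζ ∈ [ω]^ω → ∃ λ n → initial ζ n ∈ B) →
  B ⊆ C →
  (∀ s → s ∈ [ω]^<ω →
    (s ∈ C) iff (∀ n → (s ∷ʳ n) ∈ [ω]^<ω → (s ∷ʳ n) ∈ C)) →
  [] ∈ C

infix 4 _∼V_ _∼¬¬V_ _∼almostV_
infix 8 _⁺

_∼V_ : Rel 𝒩 0ℓ
α ∼V β = ∃ λ n → ∀ m → m > n → α m ≡ β m

_⁺ : Rel 𝒩 0ℓ → Rel 𝒩 0ℓ
(R ⁺) α β = ∃ λ n → ∀ m → m > n → α m ≢ β m → R α β

⋃ : (ℕ → Rel 𝒩 0ℓ) → Rel 𝒩 0ℓ
⋃ R α β = ∃ λ i → R i α β

-- Relations with the same extension are equal as sets, so a class of relations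
-- is closed under _⇔_; the constructor ext expresses this.
data 𝓔 : Rel 𝒩 0ℓ → Set₁ where
  base  : 𝓔 _∼V_
  plus  : ∀ {R} → 𝓔 R → 𝓔 (R ⁺)
  union : ∀ {R : ℕ → Rel 𝒩 0ℓ} → (∀ i → 𝓔 (R i)) → 𝓔 (⋃ R)
  ext   : ∀ {R S} → R ⇔ S → 𝓔 R → 𝓔 S

_∼¬¬V_ : Rel 𝒩 0ℓ
α ∼¬¬V β = ¬ ¬ (α ∼V β)

_∼almostV_ : Rel 𝒩 0ℓ
α ∼almostV β = ∀ ζ → ζ ∈ [ω]^ω → ∃ λ n → α (ζ n) ≡ β (ζ n)

{-# OPTIONS --safe #-}
-- For (iv), bar induction is applied to the sequences s that either meet the
-- agreement set {m | α m ≡ β m} or for which α and β are already related by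
-- some member of 𝓔.  If every one-step extension of s has this property and s
-- itself does not meet the agreement set, then beyond the last entry of s each
-- m with α m ≢ β m yields a relation Rₘ ∈ 𝓔 with Rₘ α β, so (⋃ Rₘ)⁺ relates α
-- and β.
module Submission where

open import Defs
open import Data.List.Base using (List; []; _∷_; _∷ʳ_)
open import Data.List.Relation.Unary.Any using (Any; here; any?)
open import Data.List.Relation.Unary.Any.Properties using (applyUpTo⁺; ++⁺ˡ; ++⁻)
open import Data.List.Relation.Unary.Linked using ([]; [-]; _∷_)
open import Data.List.Relation.Unary.Linked.Properties using (applyUpTo⁺₂)
open import Data.Nat.Base using (ℕ; zero; suc; _+_; _⊔_; _<_; _≤_; z≤n; s≤s)
open import Data.Nat.Properties
  using (_≟_; <-trans; ≤-<-trans; m≤n⇒m<n∨m≡n; n<1+n; m≤m⊔n; m≤n⊔m; +-monoʳ-<; m≤m+n; m≤n⇒∃[o]m+o≡n)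
open import Data.Product.Base using (_×_; ∃; _,_; proj₁; proj₂)
open import Data.Sum.Base using (_⊎_; inj₁; inj₂)
open import Function.Base using (_∘_)
open import Function.Bundles using (_⤖_; mk⇔)
open import Level using (0ℓ)
open import Relation.Binary.Core using (Rel; _⇒_)
open import Relation.Binary.PropositionalEquality using (_≡_; _≢_; refl; sym; trans)
open import Relation.Binary.Structures using (IsEquivalence)
open import Relation.Nullary using (yes; no; contradiction)
open import Relation.Nullary.Decidable using (decidable-stable)
open import Relation.Unary using (Pred; _∈_)

step-increasing⇒∈[ω]^ω : (ζ : 𝒩) → (∀ n → ζ n < ζ (suc n)) → ζ ∈ [ω]^ω
step-increasing⇒∈[ω]^ω ζ step {m} {suc n} (s≤s m≤n) with m≤n⇒m<n∨m≡n m≤n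
... | inj₁ m<n  = <-trans (step-increasing⇒∈[ω]^ω ζ step m<n) (step n)
... | inj₂ refl = step n

n≤ζ[n] : ∀ {ζ} → ζ ∈ [ω]^ω → ∀ n → n ≤ ζ n
n≤ζ[n] ζ↑ zero    = z≤n
n≤ζ[n] ζ↑ (suc n) = ≤-<-trans (n≤ζ[n] ζ↑ n) (ζ↑ (n<1+n n))

∼V-refl : ∀ {α} → α ∼V α
∼V-refl = 0 , λ _ _ → refl

∼V-sym : ∀ {α β} → α ∼V β → β ∼V α
∼V-sym (n , eq) = n , λ m m>n → sym (eq m m>n)

∼V-trans : ∀ {α β γ} → α ∼V β → β ∼V γ → α ∼V γ
∼V-trans (n , eq) (k , eq′) = n ⊔ k , λ m m>n⊔k →
  trans (eq m (≤-<-trans (m≤m⊔n n k) m>n⊔k))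
        (eq′ m (≤-<-trans (m≤n⊔m n k) m>n⊔k))

∼¬¬V-isEquivalence : IsEquivalence _∼¬¬V_
∼¬¬V-isEquivalence = record
  { refl  = λ ¬p → ¬p ∼V-refl
  ; sym   = λ p ¬q → p (¬q ∘ ∼V-sym)
  ; trans = λ p q ¬r → p λ a → q λ b → ¬r (∼V-trans a b)
  }

-- Every tail of `ζ` is again increasing, so the hypothesis yields an agreement beyond any given
-- index; iterating this builds `η`. Transitivity then applies its second hypothesis along `ζ ∘ η`.
agreeing-subsequence : ∀ α β → α ∼almostV β → ∀ ζ → ζ ∈ [ω]^ω →
  ∃ λ η → η ∈ [ω]^ω × (∀ n → α (ζ (η n)) ≡ β (ζ (η n)))
agreeing-subsequence α β α∼β ζ ζ↑ = η , step-increasing⇒∈[ω]^ω η η-step , η-agrees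
  where
  agreement-from : ∀ k → ∃ λ n → α (ζ (k + n)) ≡ β (ζ (k + n))
  agreement-from k = α∼β (ζ ∘ (k +_)) (ζ↑ ∘ +-monoʳ-< k)

  next : ℕ → ℕ
  next k = k + proj₁ (agreement-from k)

  η : 𝒩
  η zero    = next 0
  η (suc n) = next (suc (η n))

  η-step : ∀ n → η n < η (suc n)
  η-step n = m≤m+n (suc (η n)) _

  η-agrees : ∀ n → α (ζ (η n)) ≡ β (ζ (η n))
  η-agrees zero    = proj₂ (agreement-from 0)
  η-agrees (suc n) = proj₂ (agreement-from (suc (η n)))

∼almostV-trans : ∀ α β γ → α ∼almostV β → β ∼almostV γ → α ∼almostV γ
∼almostV-trans α β γ α∼β β∼γ ζ ζ↑ =
  let η , η↑ , α≡β = agreeing-subsequence α β α∼β ζ ζ↑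
      n , β≡γ      = β∼γ (ζ ∘ η) (ζ↑ ∘ η↑)
  in η n , trans (α≡β n) β≡γ

∼almostV-isEquivalence : IsEquivalence _∼almostV_
∼almostV-isEquivalence = record
  { refl  = λ _ _ → 0 , refl
  ; sym   = λ α∼β ζ ζ↑ → let n , eq = α∼β ζ ζ↑ in n , sym eq
  ; trans = λ {α} {β} {γ} → ∼almostV-trans α β γ
  }

∼V⇒𝓔 : ∀ {R} → 𝓔 R → _∼V_ ⇒ R
∼V⇒𝓔 base              α∼β = α∼β
∼V⇒𝓔 (plus e)          α∼β = 0 , λ _ _ _ → ∼V⇒𝓔 e α∼β
∼V⇒𝓔 (union e)         α∼β = 0 , ∼V⇒𝓔 (e 0) α∼β
∼V⇒𝓔 (ext (R⇒S , _) e) α∼β = R⇒S (∼V⇒𝓔 e α∼β)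

𝓔⇒∼¬¬V : ∀ {R} → 𝓔 R → R ⇒ _∼¬¬V_
𝓔⇒∼¬¬V base              α∼β ¬p = ¬p α∼β
-- Equality on `ℕ` is stable, so it suffices to refute a disagreement at `m`: it would relate `α`
-- and `β` by the smaller relation, which contradicts `¬p` by induction.
𝓔⇒∼¬¬V (plus e) {α} {β} (n , r) ¬p = ¬p (n , λ m m>n →
  decidable-stable (α m ≟ β m) λ α≢β → 𝓔⇒∼¬¬V e (r m m>n α≢β) ¬p)
𝓔⇒∼¬¬V (union e) (i , r) = 𝓔⇒∼¬¬V (e i) r
𝓔⇒∼¬¬V (ext (_ , S⇒R) e) s = 𝓔⇒∼¬¬V e (S⇒R s)

𝓔⇒∼almostV : ∀ {R} → 𝓔 R → R ⇒ _∼almostV_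
-- The index `suc n` is chosen because `ζ (suc n)` is at least `suc n`, hence strictly beyond the
-- threshold `n`.
𝓔⇒∼almostV base (n , eq) ζ ζ↑ = suc n , eq (ζ (suc n)) (n≤ζ[n] ζ↑ (suc n))
𝓔⇒∼almostV (plus e) {α} {β} (n , r) ζ ζ↑ with α (ζ (suc n)) ≟ β (ζ (suc n))
... | yes α≡β = suc n , α≡β
... | no  α≢β = 𝓔⇒∼almostV e (r (ζ (suc n)) (n≤ζ[n] ζ↑ (suc n)) α≢β) ζ ζ↑
𝓔⇒∼almostV (union e) (i , r) = 𝓔⇒∼almostV (e i) r
𝓔⇒∼almostV (ext (_ , S⇒R) e) s = 𝓔⇒∼almostV e (S⇒R s)

-- 𝓔 lives in Set₁, whereas bar induction admits only predicates in Set, so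
-- members of 𝓔 are quantified over through these codes.
data Code : Set where
  base  : Code
  plus  : Code → Code
  union : (ℕ → Code) → Code

⟦_⟧ : Code → Rel 𝒩 0ℓ
⟦ base ⟧    = _∼V_
⟦ plus c ⟧  = ⟦ c ⟧ ⁺
⟦ union c ⟧ = ⋃ (λ i → ⟦ c i ⟧)

⟦⟧∈𝓔 : ∀ c → 𝓔 ⟦ c ⟧
⟦⟧∈𝓔 base      = base
⟦⟧∈𝓔 (plus c)  = plus (⟦⟧∈𝓔 c)
⟦⟧∈𝓔 (union c) = union (λ i → ⟦⟧∈𝓔 (c i))

-- The bound `k` is the last entry of `s`; for the empty sequence any bound works, and 0 is taken.
∷ʳ-increasing : ∀ {s} → s ∈ [ω]^<ω → ∃ λ k → ∀ n → k < n → (s ∷ʳ n) ∈ [ω]^<ω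
∷ʳ-increasing []        = 0 , λ _ _ → [-]
∷ʳ-increasing {x ∷ []} [-] = x , λ _ x<n → x<n ∷ [-]
∷ʳ-increasing (x<y ∷ s↑) =
  let k , snoc = ∷ʳ-increasing s↑ in k , λ n k<n → x<y ∷ snoc n k<n

module _ (α β : 𝒩) where

  Agree : Pred ℕ 0ℓ
  Agree m = α m ≡ β m

  Related : Set
  Related = ∃ λ c → ⟦ c ⟧ α β

  Bar : Pred (List ℕ) 0ℓ
  Bar s = s ∈ [ω]^<ω × Any Agree s

  Closure : Pred (List ℕ) 0ℓ
  Closure s = s ∈ [ω]^<ω × (Any Agree s ⊎ Related)

  eventually-related : ∀ k → (∀ n → k < n → Agree n ⊎ Related) → Related
  eventually-related k agree⊎related =
    plus (union λ i → code (at i)) , k , related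
    where
    at : ∀ i → Agree (suc k + i) ⊎ Related
    at i = agree⊎related (suc k + i) (m≤m+n (suc k) i)

    code : ∀ {m} → Agree m ⊎ Related → Code
    -- A default value: `_⁺` asks for a relation only where `α` and `β` disagree, so this code is
    -- never evaluated at an agreement.
    code (inj₁ _)       = base
    code (inj₂ (c , _)) = c

    code-related : ∀ {m} (d : Agree m ⊎ Related) → α m ≢ β m → ⟦ code d ⟧ α β
    code-related (inj₁ α≡β)     α≢β = contradiction α≡β α≢β
    code-related (inj₂ (_ , r)) _   = r

    related : ∀ m → k < m → α m ≢ β m → ∃ λ i → ⟦ code (at i) ⟧ α β
    related m k<m α≢β with m≤n⇒∃[o]m+o≡n k<m
    ... | i , refl = i , code-related (at i) α≢β

  closure-hereditary : ∀ {s} → s ∈ Closure →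
    ∀ n → (s ∷ʳ n) ∈ [ω]^<ω → (s ∷ʳ n) ∈ Closure
  closure-hereditary (_ , inj₁ p) n sn↑ = sn↑ , inj₁ (++⁺ˡ p)
  closure-hereditary (_ , inj₂ r) n sn↑ = sn↑ , inj₂ r

  closure-inductive : ∀ {s} → s ∈ [ω]^<ω →
    (∀ n → (s ∷ʳ n) ∈ [ω]^<ω → (s ∷ʳ n) ∈ Closure) → s ∈ Closure
  -- Whether the finite sequence `s` meets the agreement set is decidable, which makes this case
  -- split constructive.
  closure-inductive {s} s↑ extensions with any? (λ m → α m ≟ β m) s
  ... | yes p = s↑ , inj₁ p
  ... | no ¬p = s↑ , inj₂ (eventually-related k λ n k<n →
                    last-entry (proj₂ (extensions n (snoc n k<n))))
    where
    k = proj₁ (∷ʳ-increasing s↑)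
    snoc = proj₂ (∷ʳ-increasing s↑)

    last-entry : ∀ {n} → Any Agree (s ∷ʳ n) ⊎ Related → Agree n ⊎ Related
    last-entry (inj₂ r) = inj₂ r
    -- As `s` has no agreement, one in `s ∷ʳ n` must occur at `n` itself.
    last-entry (inj₁ p) with ++⁻ s p
    ... | inj₁ q        = contradiction q ¬p
    ... | inj₂ (here e) = inj₁ e

  ∼almostV⇒related : BarInduction → α ∼almostV β → Related
  ∼almostV⇒related bar α∼β
    with bar Bar Closure proj₁ proj₁ bars (λ (s↑ , p) → s↑ , inj₁ p)
           (λ s s↑ → mk⇔ closure-hereditary (closure-inductive s↑))
    where
    bars : ∀ ζ → ζ ∈ [ω]^ω → ∃ λ n → initial ζ n ∈ Bar
    bars ζ ζ↑ = let n , eq = α∼β ζ ζ↑ in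
      -- Length `suc n` is the least for which the initial segment contains `ζ n`.
      suc n , applyUpTo⁺₂ ζ (suc n) (λ i → ζ↑ (n<1+n i)) , applyUpTo⁺ ζ eq (n<1+n n)
  -- The empty sequence meets nothing, so only the second alternative remains.
  ... | _ , inj₂ r = r

theorem11p12 : (J : (ℕ × ℕ) ⤖ ℕ) → SecondCountableChoice J → BarInduction →
    (IsEquivalence _∼¬¬V_ × IsEquivalence _∼almostV_)
    × ((R : Rel 𝒩 0ℓ) → 𝓔 R → (_∼V_ ⇒ R) × (R ⇒ _∼¬¬V_))
    × ((R : Rel 𝒩 0ℓ) → 𝓔 R → R ⇒ _∼almostV_)
    × ((α β : 𝒩) → α ∼almostV β → ∃ λ (R : Rel 𝒩 0ℓ) → 𝓔 R × R α β)
    × ((α β : 𝒩) → α ∼almostV β → α ∼¬¬V β)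
theorem11p12 _ _ bar =
    (∼¬¬V-isEquivalence , ∼almostV-isEquivalence)
  , (λ _ e → ∼V⇒𝓔 e , 𝓔⇒∼¬¬V e)
  , (λ _ e → 𝓔⇒∼almostV e)
  , (λ α β α∼β → let c , r = ∼almostV⇒related α β bar α∼β in ⟦ c ⟧ , ⟦⟧∈𝓔 c , r)
  , (λ α β α∼β → let c , r = ∼almostV⇒related α β bar α∼β in 𝓔⇒∼¬¬V (⟦⟧∈𝓔 c) r)
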